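{- Let $c\geq 2$ be an odd integer and let $0\leq a<c$ be an integer. Then \[ \overline{N}_2(a,c,n_1)\,\overline{N}_2(a,c,n_2)>\overline{N}_2(a,c,n_1+n_2) \] for all sufficiently large $n_1$ and $n_2$.
   Context: An overpartition of a nonnegative integer $n$ is a partition of $n$ in which the first occurrence of each distinct part may be overlined. For an overpartition $\lambda$, let $l(\lambda)$ be its largest part, $n(\lambda)$ its number of parts, and $n(\lambda_o)$ its number of odd non-overlined parts; let $\chi(\lambda)=1$ if $l(\lambda)$ is odd and non-overlined, and $\chi(\lambda)=0$ otherwise. The $M_2$-rank of $\lambda$ is $\lceil l(\lambda)/2\rceil-n(\lambda)-n(\lambda_o)-\chi(\lambda)$. $\overline{N}_2(a,c,n)$ denotes the number of overpartitions of $n$ whose $M_2$-rank is congruent to $a$ modulo $c$. -}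

module Defs where

open import Data.Nat using (ℕ; zero; suc; _+_; _∸_; _≤ᵇ_; _≡ᵇ_; _%_; NonZero)
open import Data.Nat.DivMod using (_/_)
open import Data.Bool using (Bool; true; false; if_then_else_; _∧_; not)
open import Data.List using (List; []; _∷_; _++_; length; filter; map; concatMap; upTo)
open import Data.Product using (_×_; _,_; proj₁; proj₂)
open import Data.Integer as ℤ using (ℤ; +_; _-_)
open import Data.Integer.DivMod using (_%ℕ_)
open import Relation.Nullary.Decidable using (⌊_⌋)
import Data.Nat as N

-- An overpartition is represented as a list of parts; each part is a pair
-- (size , overlined?).  Canonical form: parts listed in weakly decreasing
-- order of size, and among parts of equal size the (unique, optional)
-- overlined copy comes first.  Thus each overpartition of n has exactly one
-- representation in the list produced by `overpartitions n`.
Part : Set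
Part = ℕ × Bool

Overpartition : Set
Overpartition = List Part

-- gen fuel n m ov : all canonical overpartitions of n whose parts are all
-- ≤ m, where an overlined part of size m is permitted only if ov = true.
-- (fuel ≥ n guarantees completeness; each step consumes a part of size ≥ 1.)
gen : ℕ → ℕ → ℕ → Bool → List Overpartition
gen fuel zero m ov = [] ∷ []
gen zero (suc n) m ov = []
gen (suc fuel) (suc n) m ov = concatMap choose (upTo (suc m))
  where
  withOver : ℕ → List Overpartition
  withOver k = map ((k , true) ∷_) (gen fuel (suc n ∸ k) k false)
  withoutOver : ℕ → List Overpartition
  withoutOver k = map ((k , false) ∷_) (gen fuel (suc n ∸ k) k false)
  choose : ℕ → List Overpartition
  choose zero = []
  choose k@(suc _) =
    if k N.≤ᵇ suc n
    then ((if (k N.≡ᵇ m) ∧ not ov then [] else withOver k) ++ withoutOver k)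
    else []

overpartitions : ℕ → List Overpartition
overpartitions n = gen n n n true

-- largest part l(λ) (0 for the empty overpartition); with the canonical
-- ordering it is the first part.
largestPart : Overpartition → Part
largestPart [] = (0 , false)
largestPart (p ∷ _) = p

isOdd : ℕ → Bool
isOdd k = k % 2 N.≡ᵇ 1

numParts : Overpartition → ℕ
numParts = length

numOddNonOver : Overpartition → ℕ
numOddNonOver [] = 0
numOddNonOver ((k , false) ∷ ps) = (if isOdd k then 1 else 0) + numOddNonOver ps
numOddNonOver ((k , true) ∷ ps) = numOddNonOver ps

chi : Overpartition → ℕ
chi λ′ with largestPart λ′
... | (k , false) = if isOdd k then 1 else 0
... | (k , true) = 0

ceilHalf : ℕ → ℕ
ceilHalf k = (k + 1) / 2

m2rank : Overpartition → ℤ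
m2rank λ′ = + ceilHalf (proj₁ (largestPart λ′)) - + numParts λ′
            - + numOddNonOver λ′ - + chi λ′

N2 : ℕ → (c : ℕ) → .{{NonZero c}} → ℕ → ℕ
N2 a c n = length (filter (λ λ′ → (m2rank λ′ %ℕ c) N.≟ (a % c)) (overpartitions n))

{-# OPTIONS --safe #-}

-- Write p(n) for the number of overpartitions of n.
--
-- Ranks are spread over all residues: after inserting c non-overlined 4s into an overpartition
-- of n, splitting j < c of them (not the first) as 4 = 2 + 2 lowers the M₂-rank by exactly j, so
-- p(n) ≤ c N₂(a,c,n + 4c). Since p(n + 1) ≤ 3 p(n), this gives p(n) ≤ C N₂(a,c,n), and it
-- suffices that p(a + b) = o(p(a) p(b)) for a ≤ b as a → ∞.
--
-- Cut an overpartition of a + b at the part p = r + s where the partial sums cross b, padding the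
-- left piece by r ones and the right piece by s ones. The right piece alone is an overpartition of
-- a with bounded parts if p is small, and these are negligible among all overpartitions of a. If p
-- is large, the last part q ≥ p of the left piece is broken into y + 2i + 3t with y close to p: then
-- q, p and r can be read off, while t < K is arbitrary, so each overpartition has K images.
module Submission where

open import Defs
open import Data.Nat hiding (_≟_)
open import Data.Nat.Properties
open import Data.Nat.DivMod using (m≡m%n+[m/n]*n; m%n<n)
open import Data.Nat.Divisibility using (_∣_)
open import Data.Nat.Solver using (module +-*-Solver)
open import Data.Integer as ℤ using (ℤ)
import Data.Integer.Properties as ℤₚ
open import Data.Integer.DivMod using (_%ℕ_; _/ℕ_; n%ℕd<d; a≡a%ℕn+[a/ℕn]*n)
import Data.Integer.Solver as ℤSolver
open import Data.Bool using (Bool; true; false; if_then_else_; _∧_; not; T)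
open import Data.Bool.Properties using (T-∧)
open import Data.List.Base
open import Data.List.Properties
open import Data.List.Membership.Propositional using (_∈_)
open import Data.List.Membership.Propositional.Properties
open import Data.List.Relation.Unary.Any using (here; there)
open import Data.List.Relation.Unary.All as All using (All; []; _∷_)
import Data.List.Relation.Unary.All.Properties as Allₚ
import Data.List.Relation.Unary.AllPairs.Properties as Pairsₚ
open import Data.List.Relation.Unary.AllPairs using ([]; _∷_)
open import Data.List.Relation.Unary.Unique.Propositional using (Unique)
import Data.List.Relation.Unary.Unique.Propositional.Properties as Uniqueₚ
open import Data.Maybe.Base using (Maybe; just; nothing)
open import Data.Product using (_×_; _,_; proj₁; proj₂; ∃-syntax)
open import Data.Sum using (_⊎_; inj₁; inj₂)
open import Data.Unit using (tt)
open import Function using (Equivalence)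
open import Relation.Binary.Definitions using (tri<; tri≈; tri>)
open import Relation.Binary.PropositionalEquality
open import Relation.Nullary using (¬_; Dec; yes; no; contradiction)

-- Enumeration of overpartitions

length-cartesianProduct : {A B : Set} (xs : List A) (ys : List B) →
  length (cartesianProduct xs ys) ≡ length xs * length ys
length-cartesianProduct []       ys = refl
length-cartesianProduct (x ∷ xs) ys =
  trans (length-++ (map (x ,_) ys))
        (cong₂ _+_ (length-map (x ,_) ys) (length-cartesianProduct xs ys))

-- Pigeonhole for an injective relation: the image of the head is deleted from `ys`, and injectivity
-- keeps the images of the tail among the entries that remain. A relation in place of a function
-- lets an image carry its witnesses, so that decoding it is pattern matching.
length-≤-via : {A B : Set} (R : A → B → Set) →
  (∀ {x x′ y} → R x y → R x′ y → x ≡ x′) →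
  ∀ {xs ys} → Unique xs → (∀ {x} → x ∈ xs → ∃[ y ] (y ∈ ys × R x y)) →
  length xs ≤ length ys
length-≤-via R inj {[]}     []          total = z≤n
length-≤-via R inj {x ∷ xs} (x∉xs ∷ uniq) total
  with y , y∈ys , Rxy ← total (here refl)
  with us , vs , refl ← ∈-∃++ y∈ys = begin
    suc (length xs)            ≤⟨ s≤s (length-≤-via R inj uniq total′) ⟩
    suc (length (us ++ vs))    ≡⟨ cong suc (length-++ us) ⟩
    suc (length us + length vs) ≡⟨ sym (+-suc (length us) (length vs)) ⟩
    length us + suc (length vs) ≡⟨ sym (length-++ us) ⟩
    length (us ++ y ∷ vs)      ∎
  where
  open ≤-Reasoning
  total′ : ∀ {z} → z ∈ xs → ∃[ w ] (w ∈ us ++ vs × R z w)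
  total′ z∈xs with w , w∈ , Rzw ← total (there z∈xs) with ∈-++⁻ us w∈
  ... | inj₁ w∈us          = w , ∈-++⁺ˡ w∈us , Rzw
  ... | inj₂ (here refl)   = contradiction (inj Rxy Rzw) (All.lookup x∉xs z∈xs)
  ... | inj₂ (there w∈vs)  = w , ∈-++⁺ʳ us w∈vs , Rzw

-- Canonical lists and the correctness of `gen`

size : Overpartition → ℕ
size []            = 0
size ((k , _) ∷ l) = k + size l

-- The overlined copy of a size comes first, so a part of the same size as its predecessor cannot be
-- overlined.
data Below (m : ℕ) : Part → Set where
  smaller : ∀ {k o} → k < m → Below m (k , o)
  equal   : Below m (m , false)

-- Canonical m l: l may follow a part of size m in a canonical overpartition.
data Canonical (m : ℕ) : Overpartition → Set where
  []   : Canonical m []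
  cons : ∀ {k o l} → 1 ≤ k → Below m (k , o) → Canonical k l → Canonical m ((k , o) ∷ l)

choice : ℕ → ℕ → ℕ → Bool → ℕ → List Overpartition
choice fuel n m ov zero = []
choice fuel n m ov k@(suc _) =
  if k ≤ᵇ suc n
  then (if (k ≡ᵇ m) ∧ not ov then [] else map ((k , true) ∷_) (gen fuel (suc n ∸ k) k false))
       ++ map ((k , false) ∷_) (gen fuel (suc n ∸ k) k false)
  else []

-- The local function of gen cannot be named; unification finds it because the summand for
-- k = 0 vanishes and the remaining list applyUpTo suc m is neutral.
gen-unfold : ∀ fuel n m ov →
  gen (suc fuel) (suc n) m ov ≡ concat (map (choice fuel n m ov) (applyUpTo suc m))
gen-unfold fuel n m ov =
  cong concat (map-cong (λ { zero → refl ; (suc k) → refl }) (applyUpTo suc m))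

∈-if⁻ : {A : Set} {x : A} {xs : List A} (b : Bool) → x ∈ (if b then xs else []) → T b × x ∈ xs
∈-if⁻ true x∈xs = tt , x∈xs

∈-if⁺ : {A : Set} {x : A} {xs : List A} (b : Bool) → T b → x ∈ xs → x ∈ (if b then xs else [])
∈-if⁺ true _ x∈xs = x∈xs

∈-unless⁻ : {A : Set} {x : A} {xs : List A} (b : Bool) →
  x ∈ (if b then [] else xs) → ¬ T b × x ∈ xs
∈-unless⁻ false x∈xs = (λ ()) , x∈xs

∈-unless⁺ : {A : Set} {x : A} {xs : List A} (b : Bool) → ¬ T b → x ∈ xs →
  x ∈ (if b then [] else xs)
∈-unless⁺ true  ¬b x∈xs = contradiction tt ¬b
∈-unless⁺ false ¬b x∈xs = x∈xs

Unique-if : {A : Set} {xs : List A} (b : Bool) → Unique xs → Unique (if b then xs else [])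
Unique-if true  u = u
Unique-if false u = []

Unique-unless : {A : Set} {xs : List A} (b : Bool) → Unique xs → Unique (if b then [] else xs)
Unique-unless true  u = []
Unique-unless false u = u

-- The flag of `gen` turned into a preceding part: if m may be overlined, it is as if a part `suc m`
-- came before, otherwise as if a part m did.
bound : ℕ → Bool → ℕ
bound m true  = suc m
bound m false = m

Below-≤ : ∀ {m k o} → Below m (k , o) → k ≤ m
Below-≤ (smaller k<m) = <⇒≤ k<m
Below-≤ equal         = ≤-refl

Below-bound : ∀ m ov k → k ≤ m → ¬ T ((k ≡ᵇ m) ∧ not ov) → Below (bound m ov) (k , true)
Below-bound m true  k k≤m ¬top = smaller (s≤s k≤m)
Below-bound m false k k≤m ¬top with m≤n⇒m<n∨m≡n k≤m
... | inj₁ k<m  = smaller k<m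
... | inj₂ refl = contradiction (Equivalence.from T-∧ (≡⇒≡ᵇ k k refl , tt)) ¬top

Below-bound-false : ∀ m ov k → k ≤ m → Below (bound m ov) (k , false)
Below-bound-false m true  k k≤m = smaller (s≤s k≤m)
Below-bound-false m false k k≤m with m≤n⇒m<n∨m≡n k≤m
... | inj₁ k<m  = smaller k<m
... | inj₂ refl = equal

Below⇒¬top : ∀ m ov k → Below (bound m ov) (k , true) → ¬ T ((k ≡ᵇ m) ∧ not ov)
Below⇒¬top m ov    k below t with Equivalence.to (T-∧ {k ≡ᵇ m}) t
Below⇒¬top m false k (smaller k<m) t | k≡m , _ = <⇒≢ k<m (≡ᵇ⇒≡ k m k≡m)

record Choice (fuel n m : ℕ) (ov : Bool) (k : ℕ) (l : Overpartition) : Set where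
  constructor mkChoice
  field
    {over}  : Bool
    {rest}  : Overpartition
    split   : l ≡ (k , over) ∷ rest
    k≥1     : 1 ≤ k
    k≤1+n   : k ≤ suc n
    below   : Below (bound m ov) (k , over)
    rest∈   : rest ∈ gen fuel (suc n ∸ k) k false

∈-choice⁻ : ∀ fuel n m ov k {l} → k ≤ m → l ∈ choice fuel n m ov k → Choice fuel n m ov k l
∈-choice⁻ fuel n m ov k@(suc k′) k≤m l∈
  with k≤ , l∈ ← ∈-if⁻ (k ≤ᵇ suc n) l∈
  with ∈-++⁻ (if (k ≡ᵇ m) ∧ not ov then [] else map ((k , true) ∷_) (gen fuel (n ∸ k′) k false)) l∈
... | inj₁ l∈o with ¬top , l∈o ← ∈-unless⁻ ((k ≡ᵇ m) ∧ not ov) l∈o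
               with _ , r∈ , refl ← ∈-map⁻ ((k , true) ∷_) l∈o =
  mkChoice refl (s≤s z≤n) (≤ᵇ⇒≤ k (suc n) k≤) (Below-bound m ov k k≤m ¬top) r∈
... | inj₂ l∈f with _ , r∈ , refl ← ∈-map⁻ ((k , false) ∷_) l∈f =
  mkChoice refl (s≤s z≤n) (≤ᵇ⇒≤ k (suc n) k≤) (Below-bound-false m ov k k≤m) r∈

∈-choice⁺ : ∀ fuel n m ov k {l} → Choice fuel n m ov k l → l ∈ choice fuel n m ov k
∈-choice⁺ fuel n m ov k@(suc k′) (mkChoice {true} refl k≥1 k≤ below r∈) =
  ∈-if⁺ (k ≤ᵇ suc n) (≤⇒≤ᵇ k≤)
    (∈-++⁺ˡ (∈-unless⁺ ((k ≡ᵇ m) ∧ not ov) (Below⇒¬top m ov k below) (∈-map⁺ ((k , true) ∷_) r∈)))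
∈-choice⁺ fuel n m ov k@(suc k′) (mkChoice {false} refl k≥1 k≤ below r∈) =
  ∈-if⁺ (k ≤ᵇ suc n) (≤⇒≤ᵇ k≤)
    (∈-++⁺ʳ (if (k ≡ᵇ m) ∧ not ov then [] else map ((k , true) ∷_) (gen fuel (n ∸ k′) k false))
      (∈-map⁺ ((k , false) ∷_) r∈))

∈-gen⁻ : ∀ fuel n m ov {l} → l ∈ gen (suc fuel) (suc n) m ov → ∃[ k ] Choice fuel n m ov k l
∈-gen⁻ fuel n m ov l∈
  with _ , l∈c , c∈ ← ∈-concat⁻′ (map (choice fuel n m ov) (applyUpTo suc m))
                        (subst (_ ∈_) (gen-unfold fuel n m ov) l∈)
  with _ , k∈ , refl ← ∈-map⁻ (choice fuel n m ov) c∈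
  with i , i<m , refl ← ∈-applyUpTo⁻ suc k∈ = suc i , ∈-choice⁻ fuel n m ov (suc i) i<m l∈c

∈-gen⁺ : ∀ fuel n m ov {k l} → k ≤ m → Choice fuel n m ov k l → l ∈ gen (suc fuel) (suc n) m ov
∈-gen⁺ fuel n m ov {suc k} k≤m ch =
  subst (_ ∈_) (sym (gen-unfold fuel n m ov))
    (∈-concat⁺′ (∈-choice⁺ fuel n m ov (suc k) ch)
      (∈-map⁺ (choice fuel n m ov) (∈-applyUpTo⁺ suc k≤m)))
∈-gen⁺ fuel n m ov {zero} k≤m ch with () ← Choice.k≥1 ch

gen-sound : ∀ fuel n m ov {l} → l ∈ gen fuel n m ov → Canonical (bound m ov) l × size l ≡ n
gen-sound zero       zero    m ov (here refl) = [] , refl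
gen-sound (suc fuel) zero    m ov (here refl) = [] , refl
gen-sound (suc fuel) (suc n) m ov l∈
  with k , mkChoice refl k≥1 k≤ below r∈ ← ∈-gen⁻ fuel n m ov l∈
  with can , size≡ ← gen-sound fuel (suc n ∸ k) k false r∈ =
  cons k≥1 below can , trans (cong (k +_) size≡) (m+[n∸m]≡n k≤)

-- Fuel n suffices because every part is at least 1. The last hypothesis excludes a leading
-- non-overlined part `suc m`, which `Canonical (suc m)` admits but `gen` does not produce.
gen-complete : ∀ fuel {n m ov l} → Canonical (bound m ov) l → size l ≡ n → n ≤ fuel →
  (ov ≡ true → n ≤ m) → l ∈ gen fuel n m ov
gen-complete zero       [] refl n≤ top = here refl
gen-complete (suc fuel) [] refl n≤ top = here refl
gen-complete zero (cons {suc k} _ _ _) refl () top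
gen-complete (suc fuel) {n} {m} {ov} (cons {suc k} {o} {l} k≥1 below can) refl (s≤s n≤) top =
  ∈-gen⁺ fuel (k + size l) m ov (k≤m ov below top)
    (mkChoice refl k≥1 (m≤m+n (suc k) (size l)) below
      (subst (λ r → l ∈ gen fuel r (suc k) false) (sym (m+n∸m≡n (suc k) (size l)))
        (gen-complete fuel can refl (≤-trans (m≤n+m (size l) k) n≤) λ ())))
  where
  k≤m : ∀ ov → Below (bound m ov) (suc k , o) → (ov ≡ true → suc k + size l ≤ m) → suc k ≤ m
  k≤m true  _     top = ≤-trans (m≤m+n (suc k) (size l)) (top refl)
  k≤m false below _   = Below-≤ below

-- Different blocks `choice` differ in the size of the head; inside one block the two halves differ
-- in its overline.
gen-unique : ∀ fuel n m ov → Unique (gen fuel n m ov)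
gen-unique zero       zero    m ov = [] ∷ []
gen-unique (suc fuel) zero    m ov = [] ∷ []
gen-unique zero       (suc n) m ov = []
gen-unique (suc fuel) (suc n) m ov =
  subst Unique (sym (gen-unfold fuel n m ov))
    (Uniqueₚ.concat⁺ (Allₚ.map⁺ (Allₚ.applyUpTo⁺₂ suc m (λ i → choice-unique (suc i))))
      (Pairsₚ.map⁺ (Pairsₚ.applyUpTo⁺₁ suc m disjoint)))
  where
  choice-unique : ∀ k → Unique (choice fuel n m ov k)
  choice-unique zero      = []
  choice-unique k@(suc k′) = Unique-if (k ≤ᵇ suc n)
    (Uniqueₚ.++⁺ (Unique-unless ((k ≡ᵇ m) ∧ not ov) (Uniqueₚ.map⁺ ∷-injectiveʳ rec))
      (Uniqueₚ.map⁺ ∷-injectiveʳ rec) headsDiffer)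
    where
    rec = gen-unique fuel (n ∸ k′) k false
    headsDiffer : ∀ {l} → ¬ (l ∈ (if (k ≡ᵇ m) ∧ not ov then [] else
      map ((k , true) ∷_) (gen fuel (n ∸ k′) k false)) ×
      l ∈ map ((k , false) ∷_) (gen fuel (n ∸ k′) k false))
    headsDiffer (l∈o , l∈f) with _ , l∈o ← ∈-unless⁻ ((k ≡ᵇ m) ∧ not ov) l∈o
      with _ , _ , refl ← ∈-map⁻ ((k , true) ∷_) l∈o
      with _ , _ , () ← ∈-map⁻ ((k , false) ∷_) l∈f
  disjoint : ∀ {i j} → i < j → j < m → ∀ {l} →
    ¬ (l ∈ choice fuel n m ov (suc i) × l ∈ choice fuel n m ov (suc j))
  disjoint i<j j<m (l∈i , l∈j)
    with mkChoice refl _ _ _ _ ← ∈-choice⁻ fuel n m ov _ (<-trans i<j j<m) l∈i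
    with mkChoice refl _ _ _ _ ← ∈-choice⁻ fuel n m ov _ j<m l∈j = <-irrefl refl i<j

-- Operations on canonical lists

-- The flag `false` forbids an overlined m, which makes these exactly the lists of size n that
-- satisfy `Canonical m`.
boundedOverpartitions : ℕ → ℕ → List Overpartition
boundedOverpartitions m n = gen n n m false

Below-mono : ∀ {m m′ p} → m ≤ m′ → Below m p → Below m′ p
Below-mono m≤m′ (smaller k<m) = smaller (<-≤-trans k<m m≤m′)
Below-mono m≤m′ equal         = Below-bound-false _ false _ m≤m′

Canonical-mono : ∀ {m m′ l} → m ≤ m′ → Canonical m l → Canonical m′ l
Canonical-mono m≤m′ []                   = []
Canonical-mono m≤m′ (cons k≥1 below can) = cons k≥1 (Below-mono m≤m′ below) can

∈-overpartitions⁻ : ∀ {n l} → l ∈ overpartitions n → Canonical (suc n) l × size l ≡ n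
∈-overpartitions⁻ {n} = gen-sound n n n true

-- Every part is at most the size n, so any bound m can be traded for `suc n`.
∈-overpartitions⁺ : ∀ {m l n} → Canonical m l → size l ≡ n → l ∈ overpartitions n
∈-overpartitions⁺ {n = n} [] refl = here refl
∈-overpartitions⁺ {n = n} (cons {k} {o} {l} k≥1 below can) refl =
  gen-complete n (cons k≥1 (smaller (s≤s (m≤m+n k (size l)))) can) refl ≤-refl (λ _ → ≤-refl)

∈-bounded⁻ : ∀ {m n l} → l ∈ boundedOverpartitions m n → Canonical m l × size l ≡ n
∈-bounded⁻ {m} {n} = gen-sound n n m false

∈-bounded⁺ : ∀ {m n l} → Canonical m l → size l ≡ n → l ∈ boundedOverpartitions m n
∈-bounded⁺ {n = n} can size≡ = gen-complete n can size≡ ≤-refl λ ()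

overpartitions-unique : ∀ n → Unique (overpartitions n)
overpartitions-unique n = gen-unique n n n true

size-++ : ∀ l l′ → size (l ++ l′) ≡ size l + size l′
size-++ []            l′ = refl
size-++ ((k , _) ∷ l) l′ = trans (cong (k +_) (size-++ l l′)) (sym (+-assoc k _ _))

size-replicate : ∀ r k {o} → size (replicate r (k , o)) ≡ r * k
size-replicate zero    k = refl
size-replicate (suc r) k = cong (k +_) (size-replicate r k)

ones : ℕ → Overpartition
ones s = replicate s (1 , false)

size-++-ones : ∀ l s → size (l ++ ones s) ≡ size l + s
size-++-ones l s = trans (size-++ l (ones s))
  (cong (size l +_) (trans (size-replicate s 1) (*-identityʳ s)))

Canonical-replicate : ∀ {m k l} r → 1 ≤ k → k ≤ m → Canonical k l →
  Canonical m (replicate r (k , false) ++ l)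
Canonical-replicate zero    k≥1 k≤m can = Canonical-mono k≤m can
Canonical-replicate (suc r) k≥1 k≤m can =
  cons k≥1 (Below-bound-false _ false _ k≤m) (Canonical-replicate r k≥1 ≤-refl can)

Canonical-ones : ∀ {m l} s → 1 ≤ m → Canonical m l → Canonical m (l ++ ones s)
Canonical-ones s m≥1 [] =
  subst (Canonical _) (++-identityʳ (ones s)) (Canonical-replicate s ≤-refl m≥1 [])
Canonical-ones s m≥1 (cons k≥1 below can) = cons k≥1 below (Canonical-ones s k≥1 can)

Canonical-++⁻ˡ : ∀ {m} l {l′} → Canonical m (l ++ l′) → Canonical m l
Canonical-++⁻ˡ []      can                  = []
Canonical-++⁻ˡ (_ ∷ l) (cons k≥1 below can) = cons k≥1 below (Canonical-++⁻ˡ l can)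

Canonical-++⁻ʳ : ∀ {m} l {k o l′} → Canonical m (l ++ (k , o) ∷ l′) → 1 ≤ k × Canonical k l′
Canonical-++⁻ʳ []      (cons k≥1 below can) = k≥1 , can
Canonical-++⁻ʳ (_ ∷ l) (cons k≥1 below can) = Canonical-++⁻ʳ l can

Canonical⇒≤ : ∀ {m} l {k o l′} → Canonical m (l ++ (k , o) ∷ l′) → k ≤ m
Canonical⇒≤ []      (cons _ below _)   = Below-≤ below
Canonical⇒≤ (_ ∷ l) (cons _ below can) = ≤-trans (Canonical⇒≤ l can) (Below-≤ below)

Canonical⇒All≥ : ∀ {m} l {k o l′} → Canonical m (l ++ (k , o) ∷ l′) →
  All (λ p → k ≤ proj₁ p) l
Canonical⇒All≥ []      can            = []
Canonical⇒All≥ (_ ∷ l) (cons _ _ can) = Canonical⇒≤ l can ∷ Canonical⇒All≥ l can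

-- An overlined part is strictly below its predecessor and stays so when lowered; a non-overlined
-- part needs only to be weakly below.
Canonical-replace : ∀ {m} l {k k′ o r r′} → Canonical m (l ++ (k , o) ∷ r) →
  1 ≤ k′ → k′ ≤ k → Canonical k′ r′ → Canonical m (l ++ (k′ , o) ∷ r′)
Canonical-replace []      (cons k≥1 below can) k′≥1 k′≤k can′ = cons k′≥1 (lower below k′≤k) can′
  where
  lower : ∀ {m k k′ o} → Below m (k , o) → k′ ≤ k → Below m (k′ , o)
  lower (smaller k<m) k′≤k = smaller (≤-<-trans k′≤k k<m)
  lower equal         k′≤k = Below-bound-false _ false _ k′≤k
Canonical-replace (_ ∷ l) (cons k≥1 below can) k′≥1 k′≤k can′ =
  cons k≥1 below (Canonical-replace l can k′≥1 k′≤k can′)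

-- Since the prefix is free of x, the final run of x is maximal and its length can be read off.
replicate-suffix-injective : {A : Set} {x : A} (xs xs′ : List A) {r r′ : ℕ} →
  All (_≢ x) xs → All (_≢ x) xs′ →
  xs ++ replicate r x ≡ xs′ ++ replicate r′ x → xs ≡ xs′ × r ≡ r′
replicate-suffix-injective []       []         {r} {r′} _ _ eq =
  refl , trans (sym (length-replicate r)) (trans (cong length eq) (length-replicate r′))
replicate-suffix-injective []       (_ ∷ _) {suc r}  _ (x′≢ ∷ _) eq =
  contradiction (sym (∷-injectiveˡ eq)) x′≢
replicate-suffix-injective (_ ∷ _) [] {r′ = suc r′} (x≢ ∷ _) _ eq =
  contradiction (∷-injectiveˡ eq) x≢
replicate-suffix-injective (x ∷ xs) (x′ ∷ xs′) (_ ∷ a) (_ ∷ a′) eq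
  with refl , eq′ ← ∷-injective eq
  with refl , r≡ ← replicate-suffix-injective xs xs′ a a′ eq′ = refl , r≡

-- Growth of the number of overpartitions

data Shrinks (l : Overpartition) (y : Overpartition × Maybe Bool) : Set where
  drop-one : ∀ r o → l ≡ r ∷ʳ (1 , o) → y ≡ (r , just o) → Shrinks l y
  lower    : ∀ r k o → l ≡ r ∷ʳ (suc k , o) → y ≡ (r ∷ʳ (k , o) , nothing) → Shrinks l y

Shrinks-injective : ∀ {l l′ y} → Shrinks l y → Shrinks l′ y → l ≡ l′
Shrinks-injective (drop-one r o refl refl) (drop-one _ _ refl refl) = refl
Shrinks-injective (lower r k o refl refl) (lower r′ k′ o′ refl eq)
  with refl , refl ← ∷ʳ-injective r r′ (cong proj₁ eq) = refl
Shrinks-injective (drop-one _ _ _ refl) (lower _ _ _ _ ())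
Shrinks-injective (lower _ _ _ _ refl) (drop-one _ _ _ ())

-- One is subtracted from the last part. If that part is 1 it disappears and the tag keeps its
-- overline, otherwise the tag is `nothing`: three tags in all.
overpartitions-ratio : ∀ n → length (overpartitions (suc n)) ≤ 3 * length (overpartitions n)
overpartitions-ratio n = subst (length (overpartitions (suc n)) ≤_)
  (trans (length-cartesianProduct (overpartitions n) tags) (*-comm (length (overpartitions n)) 3))
  (length-≤-via Shrinks Shrinks-injective (overpartitions-unique (suc n))
    (λ {l} l∈ → let can , size≡ = ∈-overpartitions⁻ {suc n} l∈ in shrink (initLast l) can size≡))
  where
  tags : List (Maybe Bool)
  tags = just false ∷ just true ∷ nothing ∷ []
  shrink : ∀ {m l} → InitLast l → Canonical m l → size l ≡ suc n →
    ∃[ y ] (y ∈ cartesianProduct (overpartitions n) tags × Shrinks l y)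
  shrink [] can ()
  shrink (r ∷ʳ′ (zero , o)) can size≡ with () , _ ← Canonical-++⁻ʳ r can
  shrink (r ∷ʳ′ (suc zero , o)) can size≡ = (r , just o) ,
    ∈-cartesianProduct⁺ (∈-overpartitions⁺ (Canonical-++⁻ˡ r can) (suc-injective (begin
      suc (size r)             ≡⟨ +-comm 1 (size r) ⟩
      size r + 1               ≡⟨ sym (size-++ r _) ⟩
      size (r ∷ʳ (1 , o))      ≡⟨ size≡ ⟩
      suc n                    ∎))) (tag o) , drop-one r o refl refl
    where
    open ≡-Reasoning
    tag : ∀ o → just o ∈ tags
    tag false = here refl
    tag true  = there (here refl)
  shrink (r ∷ʳ′ (suc (suc k) , o)) can size≡ = (r ∷ʳ (suc k , o) , nothing) ,
    ∈-cartesianProduct⁺ (∈-overpartitions⁺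
      (Canonical-replace r can (s≤s z≤n) (n≤1+n (suc k)) []) (suc-injective (begin
        suc (size (r ∷ʳ (suc k , o)))    ≡⟨ cong suc (size-++ r _) ⟩
        suc (size r + (suc k + 0))       ≡⟨ sym (+-suc (size r) _) ⟩
        size r + suc (suc k + 0)         ≡⟨ sym (size-++ r _) ⟩
        size (r ∷ʳ (suc (suc k) , o))    ≡⟨ size≡ ⟩
        suc n                            ∎))) (there (there (here refl))) ,
      lower r (suc k) o refl refl
    where open ≡-Reasoning

-- Overpartitions with bounded parts

-- After fewer than T copies of `suc m`, the remainder satisfies `Canonical m` unless it starts with
-- an overlined m; `short⁺` takes that part out.
data LeadingRun (m T : ℕ) (l : Overpartition) : Set where
  long   : ∀ r → l ≡ replicate T (suc m , false) ++ r → Canonical (suc m) r → LeadingRun m T l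
  short  : ∀ j r → j < T → l ≡ replicate j (suc m , false) ++ r → Canonical m r → LeadingRun m T l
  short⁺ : ∀ j r → j < T → 1 ≤ m → l ≡ replicate j (suc m , false) ++ (m , true) ∷ r →
           Canonical m r → LeadingRun m T l

leadingRun : ∀ m T {l} → Canonical (suc m) l → LeadingRun m T l
leadingRun m zero    can = long _ refl can
leadingRun m (suc T) []  = short 0 [] (s≤s z≤n) refl []
leadingRun m (suc T) (cons k≥1 equal can) with leadingRun m T can
... | long r refl can′           = long r refl can′
... | short j r j<T refl can′      = short (suc j) r (s≤s j<T) refl can′
... | short⁺ j r j<T m≥1 refl can′ = short⁺ (suc j) r (s≤s j<T) m≥1 refl can′
leadingRun m (suc T) (cons {k} {o} k≥1 (smaller (s≤s k≤m)) can) with m≤n⇒m<n∨m≡n k≤m | o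
... | inj₁ k<m  | _     = short 0 _ (s≤s z≤n) refl (cons k≥1 (smaller k<m) can)
... | inj₂ refl | false = short 0 _ (s≤s z≤n) refl (cons k≥1 equal can)
... | inj₂ refl | true  = short⁺ 0 _ (s≤s z≤n) k≥1 refl can

module _ (m T : ℕ) where

  private M = suc m

  -- Either few parts M occur and are replaced by ones, recording how many, or T of them are
  -- replaced by one part larger than M, whose size encodes t, and by ones.
  data Thins : Overpartition × ℕ → (Overpartition × ℕ × Bool × ℕ) ⊎ Overpartition → Set where
    short  : ∀ {l y} j r t → l ≡ replicate j (M , false) ++ r →
             y ≡ r ++ ones (j * M) → Thins (l , t) (inj₁ (y , j , false , t))
    short⁺ : ∀ {l y} j r t → l ≡ replicate j (M , false) ++ (m , true) ∷ r →
             y ≡ r ++ ones (j * M + m) → Thins (l , t) (inj₁ (y , j , true , t))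
    long   : ∀ {l y} r t → l ≡ replicate T (M , false) ++ r →
             y ≡ (suc M + t , false) ∷ r ++ ones (T * M ∸ (suc M + t)) → Thins (l , t) (inj₂ y)

  Thins-injective : ∀ {x x′ y} → Thins x y → Thins x′ y → x ≡ x′
  Thins-injective (short j r t refl eq) (short j r′ t refl eq′)
    with refl ← ++-cancelʳ (ones (j * M)) r r′ (trans (sym eq) eq′) = refl
  Thins-injective (short⁺ j r t refl eq) (short⁺ j r′ t refl eq′)
    with refl ← ++-cancelʳ (ones (j * M + m)) r r′ (trans (sym eq) eq′) = refl
  Thins-injective (long r t refl eq) (long r′ t′ refl eq′)
    with p≡ , r≡ ← ∷-injective (trans (sym eq) eq′)
    with refl ← +-cancelˡ-≡ (suc M) t t′ (cong proj₁ p≡)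
    with refl ← ++-cancelʳ (ones (T * M ∸ (suc M + t))) r r′ r≡ = refl

bools : List Bool
bools = false ∷ true ∷ []

∈-bools : ∀ o → o ∈ bools
∈-bools false = here refl
∈-bools true  = there (here refl)

-- The pairs of an overpartition and some t < K are thinned. A short run needs the tag of its
-- length, the overline flag and t; a long run needs no tag, since t is read off the new head, for
-- which T copies of `suc m` are enough by the last hypothesis.
bounded-recursion : ∀ m T K n → T ≤ n → suc (suc m) + K ≤ T * suc m →
  length (boundedOverpartitions (suc m) n) * K ≤
  length (boundedOverpartitions m n) * (T * (2 * K)) + length (overpartitions n)
bounded-recursion m T K n T≤n room = begin
  length (boundedOverpartitions M n) * K
    ≡⟨ cong (length (boundedOverpartitions M n) *_) (sym (length-upTo K)) ⟩
  length (boundedOverpartitions M n) * length (upTo K)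
    ≡⟨ sym (length-cartesianProduct (boundedOverpartitions M n) (upTo K)) ⟩
  length (cartesianProduct (boundedOverpartitions M n) (upTo K))
    ≤⟨ length-≤-via (Thins m T) (Thins-injective m T)
         (Uniqueₚ.cartesianProduct⁺ (gen-unique n n M false) (Uniqueₚ.upTo⁺ K))
         (λ x∈ → let l∈ , t∈ = ∈-cartesianProduct⁻ (boundedOverpartitions M n) (upTo K) x∈
                 in thin l∈ (∈-upTo⁻ t∈)) ⟩
  length (map inj₁ (cartesianProduct (boundedOverpartitions m n) tags) ++ map inj₂ (overpartitions n))
    ≡⟨ length-++ (map inj₁ (cartesianProduct (boundedOverpartitions m n) tags)) ⟩
  length (map inj₁ (cartesianProduct (boundedOverpartitions m n) tags)) +
  length (map inj₂ (overpartitions n))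
    ≡⟨ cong₂ _+_ (length-map inj₁ (cartesianProduct (boundedOverpartitions m n) tags)) (length-map inj₂ (overpartitions n)) ⟩
  length (cartesianProduct (boundedOverpartitions m n) tags) + length (overpartitions n)
    ≡⟨ cong (_+ length (overpartitions n)) (length-cartesianProduct (boundedOverpartitions m n) tags) ⟩
  length (boundedOverpartitions m n) * length tags + length (overpartitions n)
    ≡⟨ cong (λ z → length (boundedOverpartitions m n) * z + length (overpartitions n)) length-tags ⟩
  length (boundedOverpartitions m n) * (T * (2 * K)) + length (overpartitions n) ∎
  where
  open ≤-Reasoning
  M = suc m
  tags : List (ℕ × Bool × ℕ)
  tags = cartesianProduct (upTo T) (cartesianProduct bools (upTo K))
  length-tags : length tags ≡ T * (2 * K)
  length-tags = trans (length-cartesianProduct (upTo T) _)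
    (cong₂ _*_ (length-upTo T) (trans (length-cartesianProduct bools (upTo K))
      (cong (2 *_) (length-upTo K))))
  ys = map inj₁ (cartesianProduct (boundedOverpartitions m n) tags) ++ map inj₂ (overpartitions n)
  size-run : ∀ j r → size (replicate j (M , false) ++ r) ≡ j * M + size r
  size-run j r = trans (size-++ (replicate j (M , false)) r)
    (cong (_+ size r) (size-replicate j M))
  tagged : ∀ {j o t y} → j < T → t < K → y ∈ boundedOverpartitions m n → inj₁ (y , j , o , t) ∈ ys
  tagged {o = o} j<T t<K y∈ = ∈-++⁺ˡ (∈-map⁺ inj₁ (∈-cartesianProduct⁺ y∈
    (∈-cartesianProduct⁺ (∈-upTo⁺ j<T) (∈-cartesianProduct⁺ (∈-bools o) (∈-upTo⁺ t<K)))))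
  thin : ∀ {l t} → l ∈ boundedOverpartitions M n → t < K → ∃[ y ] (y ∈ ys × Thins m T (l , t) y)
  thin {l} {t} l∈ t<K with can , size≡ ← ∈-bounded⁻ {M} {n} l∈ with leadingRun m T can
  ... | long r refl can′ = _ ,
    ∈-++⁺ʳ _ (∈-map⁺ inj₂ (∈-overpartitions⁺ {suc M + t + 1}
      (cons (s≤s z≤n) (smaller (≤-reflexive (+-comm 1 (suc M + t))))
        (Canonical-ones _ (s≤s z≤n) (Canonical-mono (≤-trans (n≤1+n M) (m≤m+n (suc M) t)) can′)))
      (trans sizes size≡))) , long r t refl refl
    where
    d = T * M ∸ (suc M + t)
    sizes : suc M + t + size (r ++ ones d) ≡ size (replicate T (M , false) ++ r)
    sizes = begin-equality
      suc M + t + size (r ++ ones d) ≡⟨ cong (suc M + t +_) (trans (size-++-ones r d) (+-comm (size r) d)) ⟩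
      suc M + t + (d + size r)       ≡⟨ sym (+-assoc (suc M + t) d (size r)) ⟩
      suc M + t + d + size r         ≡⟨ cong (_+ size r) (m+[n∸m]≡n
                                          (≤-trans (+-monoʳ-≤ (suc M) (<⇒≤ t<K)) room)) ⟩
      T * M + size r                 ≡⟨ sym (size-run T r) ⟩
      size (replicate T (M , false) ++ r) ∎
  ... | short j r j<T refl can′ = _ , tagged j<T t<K (∈-bounded⁺ (can″ m can′ size≡)
      (trans (size-++-ones r (j * M)) (trans (+-comm (size r) (j * M))
        (trans (sym (size-run j r)) size≡)))) , short j r t refl refl
    where
    can″ : ∀ m → Canonical m r → size (replicate j (suc m , false) ++ r) ≡ n →
      Canonical m (r ++ ones (j * suc m))
    can″ (suc m) can size≡ = Canonical-ones _ (s≤s z≤n) can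
    -- For m = 0 the list consists of j ones, so n = j < T, against `T ≤ n`.
    can″ zero [] size≡ = contradiction
      (trans (sym (trans (trans (size-++ (replicate j (1 , false)) []) (+-identityʳ _))
        (trans (size-replicate j 1) (*-identityʳ j)))) size≡)
      (<⇒≢ (<-≤-trans j<T T≤n))
    can″ zero (cons k≥1 equal _) size≡ with () ← k≥1
  ... | short⁺ j r j<T m≥1 refl can′ = _ , tagged j<T t<K (∈-bounded⁺ (Canonical-ones _ m≥1 can′)
      (trans (size-++-ones r (j * M + m)) (trans (+-comm (size r) (j * M + m))
        (trans (+-assoc (j * M) m (size r)) (trans (sym (size-run j ((m , true) ∷ r))) size≡))))) ,
      short⁺ j r t refl refl

-- Induction on m. The recursion is applied with 2K in place of K, and the induction hypothesis with
-- the constant that makes the first term at most p(n); so 2K times the count is at most 2 p(n).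
bounded-negligible : ∀ m K → ∃[ N ] (∀ n → N ≤ n →
  length (boundedOverpartitions m n) * K ≤ length (overpartitions n))
bounded-negligible zero    K = 1 , λ { (suc n) _ → z≤n }
bounded-negligible (suc m) K with N , negligible ← bounded-negligible m (suc (suc (K * 2)) * (2 * (K * 2))) =
  U ⊔ N , λ n N≤n → *-cancelʳ-≤ _ _ 2 (begin
    length (boundedOverpartitions (suc m) n) * K * 2
      ≡⟨ *-assoc (length (boundedOverpartitions (suc m) n)) K 2 ⟩
    length (boundedOverpartitions (suc m) n) * (K * 2)
      ≤⟨ bounded-recursion m U (K * 2) n (≤-trans (m≤m⊔n U N) N≤n) room ⟩
    length (boundedOverpartitions m n) * (U * (2 * (K * 2))) + length (overpartitions n)
      ≤⟨ +-monoˡ-≤ _ (negligible n (≤-trans (m≤n⊔m U N) N≤n)) ⟩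
    length (overpartitions n) + length (overpartitions n)
      ≡⟨ cong (length (overpartitions n) +_) (sym (+-identityʳ _)) ⟩
    2 * length (overpartitions n)
      ≡⟨ *-comm 2 (length (overpartitions n)) ⟩
    length (overpartitions n) * 2 ∎)
  where
  open ≤-Reasoning
  -- U serves as T: this many copies of `suc m` outweigh a part of size `suc (suc m) + 2K`.
  U = suc (suc (K * 2))
  room : suc (suc m) + K * 2 ≤ U * suc m
  room = begin
    suc (suc m) + K * 2             ≡⟨ cong suc (sym (+-suc m (K * 2))) ⟩
    suc m + suc (K * 2)             ≤⟨ +-monoʳ-≤ (suc m) (m≤m*n (suc (K * 2)) (suc m)) ⟩
    suc m + suc (K * 2) * suc m     ∎

-- Cutting an overpartition in two

open +-*-Solver using (solve; _:+_; _:*_; _:=_; con)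

-- The part r + s has r units up to position b and s units after it; r is 0 when a partial sum
-- equals b.
record Crossing (b : ℕ) (l : Overpartition) : Set where
  constructor mkCrossing
  field
    pre suf : Overpartition
    r s     : ℕ
    o       : Bool
    split   : l ≡ pre ++ (r + s , o) ∷ suf
    size-pre : size pre + r ≡ b

crossing : ∀ b l → b < size l → Crossing b l
crossing b ((k , o) ∷ l) b<size with k ≤? b
... | no k≰b = mkCrossing [] l b (k ∸ b) o
      (cong (λ z → (z , o) ∷ l) (sym (m+[n∸m]≡n (≰⇒≥ k≰b)))) refl
... | yes k≤b with mkCrossing pre suf r s o′ refl size-pre ← crossing (b ∸ k) l
        (+-cancelˡ-< k _ _ (subst (_< k + size l) (sym (m+[n∸m]≡n k≤b)) b<size)) =
      mkCrossing ((k , o) ∷ pre) suf r s o′ refl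
        (trans (+-assoc k (size pre) r) (trans (cong (k +_) size-pre) (m+[n∸m]≡n k≤b)))

size-suf : ∀ pre suf {r s o a b} → size (pre ++ (r + s , o) ∷ suf) ≡ a + b →
  size pre + r ≡ b → size suf + s ≡ a
size-suf pre suf {r} {s} {o} {a} {b} total refl = +-cancelʳ-≡ b _ _ (begin
  size suf + s + (size pre + r)
    ≡⟨ solve 4 (λ x y z w → x :+ y :+ (z :+ w) := z :+ (w :+ y :+ x)) refl (size suf) s (size pre) r ⟩
  size pre + (r + s + size suf)            ≡⟨ sym (size-++ pre _) ⟩
  size (pre ++ (r + s , o) ∷ suf)          ≡⟨ total ⟩
  a + b                                    ∎)
  where open ≡-Reasoning

-- Storing numbers as multiplicities of the parts 3, 2 and 1

mark : Overpartition → ℕ → ℕ → ℕ → Overpartition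
mark l t i r = ((l ++ replicate t (3 , false)) ++ replicate i (2 , false)) ++ ones r

mark-assoc : ∀ l x t i r →
  mark (l ∷ʳ x) t i r ≡ l ++ x ∷ replicate t (3 , false) ++ replicate i (2 , false) ++ ones r
mark-assoc l x t i r = begin
  (((l ∷ʳ x) ++ X₃) ++ X₂) ++ ones r   ≡⟨ ++-assoc ((l ∷ʳ x) ++ X₃) X₂ (ones r) ⟩
  ((l ∷ʳ x) ++ X₃) ++ X₂ ++ ones r     ≡⟨ ++-assoc (l ∷ʳ x) X₃ _ ⟩
  (l ∷ʳ x) ++ X₃ ++ X₂ ++ ones r       ≡⟨ ++-assoc l (x ∷ []) _ ⟩
  l ++ x ∷ X₃ ++ X₂ ++ ones r          ∎
  where
  open ≡-Reasoning
  X₃ = replicate t (3 , false)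
  X₂ = replicate i (2 , false)

size-mark : ∀ l t i r → size (mark l t i r) ≡ size l + (3 * t + 2 * i + r)
size-mark l t i r = begin
  size (mark l t i r)                     ≡⟨ size-++-ones ((l ++ X₃) ++ X₂) r ⟩
  size ((l ++ X₃) ++ X₂) + r                ≡⟨ cong (_+ r) (size-++ (l ++ X₃) X₂) ⟩
  size (l ++ X₃) + size X₂ + r              ≡⟨ cong₂ (λ u v → u + v + r) (size-++ l X₃) (size-replicate i 2) ⟩
  size l + size X₃ + i * 2 + r             ≡⟨ cong (λ u → size l + u + i * 2 + r) (size-replicate t 3) ⟩
  size l + t * 3 + i * 2 + r
    ≡⟨ solve 4 (λ z t i r → z :+ t :* con 3 :+ i :* con 2 :+ r :=
                            z :+ (con 3 :* t :+ con 2 :* i :+ r)) refl (size l) t i r ⟩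
  size l + (3 * t + 2 * i + r)            ∎
  where
  open ≡-Reasoning
  X₃ = replicate t (3 , false)
  X₂ = replicate i (2 , false)

Canonical-mark : ∀ {m} l {k y o rest} t i r → Canonical m (l ++ (k , o) ∷ rest) → 4 ≤ y → y ≤ k →
  Canonical m (mark (l ∷ʳ (y , o)) t i r)
Canonical-mark l t i r can 4≤y y≤k = subst (Canonical _) (sym (mark-assoc l _ t i r))
  (Canonical-replace l can (≤-trans (s≤s z≤n) 4≤y) y≤k
    (Canonical-replicate t (s≤s z≤n) (≤-trans (n≤1+n 3) 4≤y)
      (Canonical-replicate i (s≤s z≤n) (n≤1+n 2) (Canonical-ones r (s≤s z≤n) []))))

Large : Overpartition → Set
Large = All (λ p → 4 ≤ proj₁ p)

Large⇒≢ : ∀ {l} k → k < 4 → Large l → All (_≢ (k , false)) l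
Large⇒≢ k k<4 = All.map λ { 4≤ refl → <⇒≱ k<4 4≤ }

-- The final runs of 1, 2 and 3 are peeled off in this order, each from a prefix that lacks the part
-- in question; parts of size at least 4 cannot be confused with the marks.
mark-injective : ∀ l t i r l′ t′ i′ r′ → Large l → Large l′ →
  mark l t i r ≡ mark l′ t′ i′ r′ → l ≡ l′ × t ≡ t′ × i ≡ i′ × r ≡ r′
mark-injective l t i r l′ t′ i′ r′ big big′ eq =
  let eq₂ , r≡ = replicate-suffix-injective _ _ (no1 l t i big) (no1 l′ t′ i′ big′) eq
      eq₃ , i≡ = replicate-suffix-injective _ _ (no2 l t big) (no2 l′ t′ big′) eq₂
      l≡ , t≡ = replicate-suffix-injective l l′ (Large⇒≢ 3 ≤-refl big) (Large⇒≢ 3 ≤-refl big′) eq₃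
  in l≡ , t≡ , i≡ , r≡
  where
  no2 : ∀ l t → Large l → All (_≢ (2 , false)) (l ++ replicate t (3 , false))
  no2 l t big = Allₚ.++⁺ (Large⇒≢ 2 (n≤1+n 3) big) (Allₚ.replicate⁺ t λ ())
  no1 : ∀ l t i → Large l →
    All (_≢ (1 , false)) ((l ++ replicate t (3 , false)) ++ replicate i (2 , false))
  no1 l t i big = Allₚ.++⁺ (Allₚ.++⁺ (Large⇒≢ 1 (s≤s (s≤s z≤n)) big)
    (Allₚ.replicate⁺ t λ ())) (Allₚ.replicate⁺ i λ ())

-- The tags `first` and `large` will take 4 + 2 * 2 = 8 values, whatever K is. The tags `small` grow
-- in number with K, but go only with right pieces that have bounded parts.
data Tag : Set where
  first : ℕ → Tag
  large : ℕ → Bool → Tag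
  small : ℕ × ℕ × Bool × ℕ → Tag

-- large: q − p = 2i + e, and q is replaced by y = p + e − 3t together with t threes and i twos.
-- first: no part precedes p = b + s, so b itself is broken up and i encodes s = 4i + e instead.
data Splits (b : ℕ) : Overpartition × ℕ → (Overpartition × Overpartition) × Tag → Set where
  first : ∀ {l t μ ν e} suf s o i y →
    l ≡ (b + s , o) ∷ suf → s ≡ e + i * 4 → y + (3 * t + 2 * i + 0) ≡ b → 4 ≤ y →
    μ ≡ mark ((y , o) ∷ []) t i 0 → ν ≡ suf ++ ones s →
    Splits b (l , t) ((μ , ν) , first e)
  large : ∀ {l t μ ν e o} pre suf q o′ r s i y →
    l ≡ pre ++ (q , o′) ∷ (r + s , o) ∷ suf → Large pre →
    q ≡ e + i * 2 + (r + s) → y + 3 * t ≡ r + s + e → 4 ≤ y →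
    μ ≡ mark (pre ∷ʳ (y , o′)) t i r → ν ≡ suf ++ ones s →
    Splits b (l , t) ((μ , ν) , large e o)
  small : ∀ {l t μ ν r s o} pre suf → l ≡ pre ++ (r + s , o) ∷ suf →
    μ ≡ pre ++ ones r → ν ≡ suf ++ ones s →
    Splits b (l , t) ((μ , ν) , small (r , s , o , t))

-- Decoding order: the marks on the left piece give y, t, i and r; then s follows from s = e + 4i or
-- from y + 3t = r + s + e; then q; finally s ones are removed from the right piece. A `small` tag
-- holds its data openly.
Splits-injective : ∀ {b x x′ y} → Splits b x y → Splits b x′ y → x ≡ x′
Splits-injective (first {t = t} suf s o i y refl s≡ b≡ 4≤y refl ν≡)
                 (first {t = t′} suf′ s′ o′ i′ y′ refl s′≡ b′≡ 4≤y′ μ≡ ν′≡)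
  with refl , refl , refl , _ ← mark-injective ((y , o) ∷ []) t i 0 ((y′ , o′) ∷ []) t′ i′ 0
         (4≤y ∷ []) (4≤y′ ∷ []) μ≡
  with refl ← trans s≡ (sym s′≡)
  with refl ← ++-cancelʳ (ones s) suf suf′ (trans (sym ν≡) ν′≡) = refl
Splits-injective (large {t = t} {e = e} pre suf q o r s i y refl big q≡ y≡ 4≤y refl ν≡)
                 (large {t = t′} pre′ suf′ q′ o′ r′ s′ i′ y′ refl big′ q′≡ y′≡ 4≤y′ μ≡ ν′≡)
  with pre≡ , refl , refl , refl ← mark-injective (pre ∷ʳ (y , o)) t i r (pre′ ∷ʳ (y′ , o′)) t′ i′ r′
         (Allₚ.∷ʳ⁺ big 4≤y) (Allₚ.∷ʳ⁺ big′ 4≤y′) μ≡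
  with refl , refl ← ∷ʳ-injective pre pre′ pre≡
  with refl ← +-cancelˡ-≡ r s s′ (+-cancelʳ-≡ e _ _ (trans (sym y≡) y′≡))
  with refl ← trans q≡ (sym q′≡)
  with refl ← ++-cancelʳ (ones s) suf suf′ (trans (sym ν≡) ν′≡) = refl
Splits-injective (small {r = r} {s} pre suf refl refl refl) (small pre′ suf′ refl μ≡ ν≡)
  with refl ← ++-cancelʳ (ones r) pre pre′ μ≡
  with refl ← ++-cancelʳ (ones s) suf suf′ ν≡ = refl

module _ (a b K : ℕ) (a≤b : a ≤ b) (a≥1 : 1 ≤ a) (b-large : 2 * (3 * K + 4) ≤ b) where

  private
    -- From a part of size at least P, three times any t < K can be taken so that at least 4 is
    -- left.
    P = 3 * K + 4

    coarse : List Tag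
    coarse = map first (upTo 4) ++ cartesianProductWith large (upTo 2) bools

    fine : List (ℕ × ℕ × Bool × ℕ)
    fine = cartesianProduct (upTo P) (cartesianProduct (upTo P) (cartesianProduct bools (upTo K)))

    ys₁ ys₂ ys : List ((Overpartition × Overpartition) × Tag)
    ys₁ = cartesianProduct (cartesianProduct (overpartitions b) (overpartitions a)) coarse
    ys₂ = cartesianProduct (cartesianProduct (overpartitions b) (boundedOverpartitions P a)) (map small fine)
    ys = ys₁ ++ ys₂

    length-fine : length fine ≡ P * (P * (2 * K))
    length-fine = trans (length-cartesianProduct (upTo P) _) (cong₂ _*_ (length-upTo P)
      (trans (length-cartesianProduct (upTo P) _) (cong₂ _*_ (length-upTo P)
        (trans (length-cartesianProduct bools (upTo K)) (cong (2 *_) (length-upTo K))))))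

    length-ys : length ys ≡ length (overpartitions b) * length (overpartitions a) * 8 +
      length (overpartitions b) * length (boundedOverpartitions P a) * (P * (P * (2 * K)))
    length-ys = trans (length-++ ys₁) (cong₂ _+_
      (trans (length-cartesianProduct (cartesianProduct (overpartitions b) (overpartitions a)) coarse)
        (cong (_* 8) (length-cartesianProduct (overpartitions b) (overpartitions a))))
      (trans (length-cartesianProduct (cartesianProduct (overpartitions b) (boundedOverpartitions P a)) (map small fine))
        (cong₂ _*_ (length-cartesianProduct (overpartitions b) (boundedOverpartitions P a))
          (trans (length-map small fine) length-fine))))

    3t≤ : ∀ {t} → t < K → 3 * t ≤ 3 * K
    3t≤ t<K = *-monoʳ-≤ 3 (<⇒≤ t<K)

    coarse∈ : ∀ {m m′ μ ν g} → Canonical m μ → size μ ≡ b → Canonical m′ ν → size ν ≡ a →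
      g ∈ coarse → ((μ , ν) , g) ∈ ys
    coarse∈ canμ sizeμ canν sizeν g∈ = ∈-++⁺ˡ (∈-cartesianProduct⁺
      (∈-cartesianProduct⁺ (∈-overpartitions⁺ canμ sizeμ) (∈-overpartitions⁺ canν sizeν)) g∈)

  split-first : ∀ {m t} suf s o → t < K → Canonical m ((b + s , o) ∷ suf) → size suf + s ≡ a →
    ∃[ y ] (y ∈ ys × Splits b ((b + s , o) ∷ suf , t) y)
  split-first {m} {t} suf s o t<K can@(cons p≥1 below can′) size≡ = _ ,
    coarse∈ (Canonical-mark [] t i 0 can 4≤y (≤-trans (m∸n≤m b cost) (m≤m+n b s)))
      (trans (size-mark ((y , o) ∷ []) t i 0)
        (trans (cong (_+ cost) (+-identityʳ y)) y+cost))
      (Canonical-ones s p≥1 can′) (trans (size-++-ones suf s) size≡)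
      (∈-++⁺ˡ (∈-map⁺ first (∈-upTo⁺ (m%n<n s 4)))) ,
    first suf s o i y refl (m≡m%n+[m/n]*n s 4) y+cost 4≤y refl refl
    where
    open ≤-Reasoning
    -- Division by 4 keeps the twos cheap: 2i is at most s / 2, hence at most b / 2, and by
    -- `b-large` the other half of b covers 3t + 4.
    i = s / 4
    cost = 3 * t + 2 * i + 0
    y = b ∸ cost
    4+cost≤b : 4 + cost ≤ b
    4+cost≤b = *-cancelˡ-≤ 2 (begin
      2 * (4 + cost)
        ≡⟨ solve 2 (λ t i → con 2 :* (con 4 :+ (con 3 :* t :+ con 2 :* i :+ con 0)) :=
                            i :* con 4 :+ con 2 :* (con 3 :* t :+ con 4)) refl t i ⟩
      i * 4 + 2 * (3 * t + 4)
        ≤⟨ +-mono-≤ (≤-trans (m≤n+m (i * 4) (s % 4)) (≤-reflexive (sym (m≡m%n+[m/n]*n s 4))))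
                    (*-monoʳ-≤ 2 (+-monoˡ-≤ 4 (3t≤ t<K))) ⟩
      s + 2 * (3 * K + 4)
        ≤⟨ +-mono-≤ (≤-trans (m≤n+m s (size suf)) (≤-trans (≤-reflexive size≡) a≤b)) b-large ⟩
      b + b
        ≡⟨ cong (b +_) (sym (+-identityʳ b)) ⟩
      2 * b ∎)
    y+cost : y + cost ≡ b
    y+cost = m∸n+n≡m (≤-trans (m≤n+m cost 4) 4+cost≤b)
    4≤y : 4 ≤ y
    4≤y = m+n≤o⇒m≤o∸n 4 4+cost≤b

  split-large : ∀ {m t} pre suf q o′ r s o → t < K →
    Canonical m (pre ++ (q , o′) ∷ (r + s , o) ∷ suf) → P ≤ r + s →
    size (pre ∷ʳ (q , o′)) + r ≡ b → size suf + s ≡ a →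
    ∃[ y ] (y ∈ ys × Splits b (pre ++ (q , o′) ∷ (r + s , o) ∷ suf , t) y)
  split-large {m} {t} pre suf q o′ r s o t<K can P≤p size-pre size≡
    with q≥1 , cons p≥1 below can′ ← Canonical-++⁻ʳ pre can = _ ,
    coarse∈ (Canonical-mark pre t i r can 4≤y y≤q) size-μ
      (Canonical-ones s p≥1 can′) (trans (size-++-ones suf s) size≡)
      (∈-++⁺ʳ (map first (upTo 4)) (∈-cartesianProductWith⁺ large (∈-upTo⁺ (m%n<n d 2)) (∈-bools o))) ,
    large pre suf q o′ r s i y refl
      (All.map (≤-trans (≤-trans 4≤y y≤q)) (Canonical⇒All≥ pre can)) q≡ y+3t 4≤y refl refl
    where
    open ≤-Reasoning
    p = r + s
    d = q ∸ p
    i = d / 2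
    e = d % 2
    -- Then y + 3t + 2i = q, so the left piece keeps its size, and y is at most q, so its order. The
    -- new part y inherits the overline of q; that of p goes into the tag.
    y = (p + e) ∸ 3 * t
    p≤q : p ≤ q
    p≤q with _ , cons _ below _ ← Canonical-++⁻ʳ pre can = Below-≤ below
    q≡ : q ≡ e + i * 2 + p
    q≡ = trans (sym (m∸n+n≡m p≤q)) (cong (_+ p) (m≡m%n+[m/n]*n d 2))
    4+3t≤p+e : 4 + 3 * t ≤ p + e
    4+3t≤p+e = begin
      4 + 3 * t  ≤⟨ +-monoʳ-≤ 4 (3t≤ t<K) ⟩
      4 + 3 * K  ≡⟨ +-comm 4 (3 * K) ⟩
      P          ≤⟨ P≤p ⟩
      p          ≤⟨ m≤m+n p e ⟩
      p + e      ∎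
    y+3t : y + 3 * t ≡ p + e
    y+3t = m∸n+n≡m (≤-trans (m≤n+m (3 * t) 4) 4+3t≤p+e)
    4≤y : 4 ≤ y
    4≤y = m+n≤o⇒m≤o∸n 4 4+3t≤p+e
    y≤q : y ≤ q
    y≤q = begin
      y              ≤⟨ m∸n≤m (p + e) (3 * t) ⟩
      p + e          ≡⟨ +-comm p e ⟩
      e + p          ≤⟨ +-monoˡ-≤ p (m≤m+n e (i * 2)) ⟩
      e + i * 2 + p  ≡⟨ sym q≡ ⟩
      q              ∎
    size-μ : size (mark (pre ∷ʳ (y , o′)) t i r) ≡ b
    size-μ = begin-equality
      size (mark (pre ∷ʳ (y , o′)) t i r)       ≡⟨ size-mark (pre ∷ʳ (y , o′)) t i r ⟩
      size (pre ∷ʳ (y , o′)) + (3 * t + 2 * i + r) ≡⟨ cong (_+ (3 * t + 2 * i + r)) (size-++ pre _) ⟩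
      size pre + (y + 0) + (3 * t + 2 * i + r)
        ≡⟨ solve 5 (λ z y t i r → z :+ (y :+ con 0) :+ (con 3 :* t :+ con 2 :* i :+ r) :=
                                  z :+ (y :+ con 3 :* t :+ i :* con 2) :+ r) refl (size pre) y t i r ⟩
      size pre + (y + 3 * t + i * 2) + r        ≡⟨ cong (λ z → size pre + (z + i * 2) + r) y+3t ⟩
      size pre + (p + e + i * 2) + r
        ≡⟨ cong (λ z → size pre + z + r) (solve 3 (λ p e j → p :+ e :+ j := e :+ j :+ p :+ con 0) refl p e (i * 2)) ⟩
      size pre + (e + i * 2 + p + 0) + r        ≡⟨ cong (λ z → size pre + (z + 0) + r) (sym q≡) ⟩
      size pre + (q + 0) + r                    ≡⟨ cong (_+ r) (sym (size-++ pre _)) ⟩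
      size (pre ∷ʳ (q , o′)) + r                ≡⟨ size-pre ⟩
      b ∎

  split-small : ∀ {m t} pre suf r s o → 1 ≤ m → t < K → Canonical m (pre ++ (r + s , o) ∷ suf) →
    r + s < P → size pre + r ≡ b → size suf + s ≡ a →
    ∃[ y ] (y ∈ ys × Splits b (pre ++ (r + s , o) ∷ suf , t) y)
  split-small pre suf r s o m≥1 t<K can p<P size-pre size≡
    with p≥1 , can′ ← Canonical-++⁻ʳ pre can = _ ,
    ∈-++⁺ʳ ys₁ (∈-cartesianProduct⁺ (∈-cartesianProduct⁺
      (∈-overpartitions⁺ (Canonical-ones r m≥1 (Canonical-++⁻ˡ pre can))
        (trans (size-++-ones pre r) size-pre))
      -- The right piece follows the part p, so p < P puts it among the negligible bounded
      -- overpartitions.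
      (∈-bounded⁺ (Canonical-mono (<⇒≤ p<P) (Canonical-ones s p≥1 can′))
        (trans (size-++-ones suf s) size≡)))
      (∈-map⁺ small (∈-cartesianProduct⁺ (∈-upTo⁺ (≤-<-trans (m≤m+n r s) p<P))
        (∈-cartesianProduct⁺ (∈-upTo⁺ (≤-<-trans (m≤n+m s r) p<P))
          (∈-cartesianProduct⁺ (∈-bools o) (∈-upTo⁺ t<K)))))) ,
    small pre suf refl refl refl

  split : ∀ {l t} → l ∈ overpartitions (a + b) → t < K → ∃[ y ] (y ∈ ys × Splits b (l , t) y)
  split {l} {t} l∈ t<K
    with can , size≡ ← ∈-overpartitions⁻ {a + b} l∈
    with mkCrossing pre suf r s o refl size-pre ← crossing b l
           -- Since a is at least 1, position b lies strictly before the end.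
           (subst (b <_) (sym size≡) (+-monoˡ-≤ b a≥1))
    with r + s <? P
  ... | yes p<P = split-small pre suf r s o (s≤s z≤n) t<K can p<P size-pre
                    (size-suf pre suf size≡ size-pre)
  ... | no  p≮P = not-small (initLast pre) can size-pre (size-suf pre suf size≡ size-pre)
    where
    not-small : ∀ {pre m} → InitLast pre → Canonical m (pre ++ (r + s , o) ∷ suf) →
      size pre + r ≡ b → size suf + s ≡ a →
      ∃[ y ] (y ∈ ys × Splits b (pre ++ (r + s , o) ∷ suf , t) y)
    -- No part precedes the crossing part, so r = b.
    not-small []                can refl size≡ = split-first suf s o t<K can size≡
    not-small (pre ∷ʳ′ (q , o′)) can size-pre size≡ =
      subst (λ l → ∃[ y ] (y ∈ ys × Splits b (l , t) y)) (sym (++-assoc pre _ _))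
        (split-large pre suf q o′ r s o t<K (subst (Canonical _) (++-assoc pre _ _) can)
          (≮⇒≥ p≮P) size-pre size≡)

  overpartitions-split : length (overpartitions (a + b)) * K ≤
    length (overpartitions b) * length (overpartitions a) * 8 +
    length (overpartitions b) * length (boundedOverpartitions P a) * (P * (P * (2 * K)))
  overpartitions-split = begin
    length (overpartitions (a + b)) * K
      ≡⟨ cong (length (overpartitions (a + b)) *_) (sym (length-upTo K)) ⟩
    length (overpartitions (a + b)) * length (upTo K)
      ≡⟨ sym (length-cartesianProduct (overpartitions (a + b)) (upTo K)) ⟩
    length (cartesianProduct (overpartitions (a + b)) (upTo K))
      ≤⟨ length-≤-via (Splits b) Splits-injective
           (Uniqueₚ.cartesianProduct⁺ (overpartitions-unique (a + b)) (Uniqueₚ.upTo⁺ K))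
           (λ x∈ → let l∈ , t∈ = ∈-cartesianProduct⁻ (overpartitions (a + b)) (upTo K) x∈
                   in split l∈ (∈-upTo⁻ t∈)) ⟩
    length ys
      ≡⟨ length-ys ⟩
    _ ∎
    where open ≤-Reasoning

-- The 9 is 8 for the coarse tags plus 1 for the bounded right pieces, whose scarcity for large a
-- absorbs the number of fine tags.
overpartitions-supermultiplicative : ∀ K → ∃[ N ] (∀ a b → a ≤ b → N ≤ a →
  length (overpartitions (a + b)) * K ≤ 9 * (length (overpartitions a) * length (overpartitions b)))
overpartitions-supermultiplicative K
  with N , negligible ← bounded-negligible (3 * K + 4) ((3 * K + 4) * ((3 * K + 4) * (2 * K))) =
  -- The first entry gives `b-large` through a ≤ b; `suc N` gives both 1 ≤ a and N ≤ a.
  2 * (3 * K + 4) ⊔ suc N , λ a b a≤b N≤a →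
    let open ≤-Reasoning
        P = 3 * K + 4
        p = λ n → length (overpartitions n)
        q = length (boundedOverpartitions P a)
        M = P * (P * (2 * K))
        N<a = ≤-trans (m≤n⊔m (2 * P) (suc N)) N≤a
    in begin
      p (a + b) * K
        ≤⟨ overpartitions-split a b K a≤b (≤-trans (s≤s z≤n) N<a)
             (≤-trans (≤-trans (m≤m⊔n (2 * P) (suc N)) N≤a) a≤b) ⟩
      p b * p a * 8 + p b * q * M
        ≡⟨ cong (p b * p a * 8 +_) (*-assoc (p b) q M) ⟩
      p b * p a * 8 + p b * (q * M)
        ≤⟨ +-monoʳ-≤ (p b * p a * 8) (*-monoʳ-≤ (p b) (negligible a (<⇒≤ N<a))) ⟩
      p b * p a * 8 + p b * p a
        ≡⟨ solve 2 (λ x y → x :* y :* con 8 :+ x :* y := con 9 :* (y :* x)) refl (p b) (p a) ⟩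
      9 * (p a * p b) ∎

-- Ranks

open import Data.Integer using (+_)

-- Two remainders below d differ by a multiple of d whose absolute value is less than d, hence by 0.
%ℕ-unique : ∀ z q r d .{{_ : NonZero d}} → r < d → z ≡ + r ℤ.+ q ℤ.* + d → z %ℕ d ≡ r
%ℕ-unique z q r d r<d z≡ = ℤₚ.+-injective (ℤₚ.i-j≡0⇒i≡j (+ r′) (+ r) (ℤₚ.∣i∣≡0⇒i≡0 (zero-abs k abs≡)))
  where
  r′ = z %ℕ d
  k = ℤ.∣ q ℤ.- z /ℕ d ∣
  diff : + r′ ℤ.- + r ≡ (q ℤ.- z /ℕ d) ℤ.* + d
  diff = begin
    + r′ ℤ.- + r
      ≡⟨ solveℤ 4 (λ r′ r p d → r′ :- r :=′ (r′ :+′ p :*′ d) :- r :- p :*′ d) refl (+ r′) (+ r) (z /ℕ d) (+ d) ⟩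
    (+ r′ ℤ.+ z /ℕ d ℤ.* + d) ℤ.- + r ℤ.- z /ℕ d ℤ.* + d
      ≡⟨ cong (λ w → w ℤ.- + r ℤ.- z /ℕ d ℤ.* + d) (trans (sym (a≡a%ℕn+[a/ℕn]*n z d)) z≡) ⟩
    (+ r ℤ.+ q ℤ.* + d) ℤ.- + r ℤ.- z /ℕ d ℤ.* + d
      ≡⟨ solveℤ 4 (λ r q p d → (r :+′ q :*′ d) :- r :- p :*′ d :=′ (q :- p) :*′ d) refl (+ r) q (z /ℕ d) (+ d) ⟩
    (q ℤ.- z /ℕ d) ℤ.* + d ∎
    where
    open ≡-Reasoning
    open ℤSolver.+-*-Solver using (_:-_) renaming (solve to solveℤ; _:=_ to _:=′_; _:+_ to _:+′_; _:*_ to _:*′_)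
  abs≡ : ℤ.∣ + r′ ℤ.- + r ∣ ≡ k * d
  abs≡ = trans (cong ℤ.∣_∣ diff) (ℤₚ.abs-* (q ℤ.- z /ℕ d) (+ d))
  abs< : ℤ.∣ + r′ ℤ.- + r ∣ < d
  abs< = ≤-<-trans (≤-trans (≤-reflexive (cong ℤ.∣_∣ (ℤₚ.m-n≡m⊖n r′ r))) (ℤₚ.∣m⊝n∣≤m⊔n r′ r))
    (⊔-lub (n%ℕd<d z d) r<d)
  zero-abs : ∀ k → ℤ.∣ + r′ ℤ.- + r ∣ ≡ k * d → ℤ.∣ + r′ ℤ.- + r ∣ ≡ 0
  zero-abs zero    eq = eq
  zero-abs (suc k) eq = contradiction (subst (d ≤_) (sym eq) (m≤m+n d (k * d))) (<⇒≱ abs<)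

-- Inserting parts in canonical order

below? : ∀ k p → Dec (Below k p)
below? k (j , o) with <-cmp j k
below? k (j , o)     | tri< j<k _ _  = yes (smaller j<k)
below? k (j , false) | tri≈ _ refl _ = yes equal
below? k (j , true)  | tri≈ ¬< refl _ = no λ { (smaller j<k) → ¬< j<k }
below? k (j , o)     | tri> ¬< ¬≡ _  = no λ { (smaller j<k) → ¬< j<k ; equal → ¬≡ refl }

-- The new copy goes in front of the first part that may follow a part k, hence behind an overlined
-- k.
insert : ℕ → Overpartition → Overpartition
insert k []      = (k , false) ∷ []
insert k (p ∷ l) with below? k p
... | yes _ = (k , false) ∷ p ∷ l
... | no  _ = p ∷ insert k l

-- A left inverse of `insert k`: in a list just made by `insert k`, the first part that may follow a
-- part k is the new copy.
erase : ℕ → Overpartition → Overpartition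
erase k []      = []
erase k (p ∷ l) with below? k p
... | yes _ = l
... | no  _ = p ∷ erase k l

erase-head : ∀ k l → erase k ((k , false) ∷ l) ≡ l
erase-head k l with below? k (k , false)
... | yes _      = refl
... | no  ¬below = contradiction equal ¬below

erase-insert : ∀ k l → erase k (insert k l) ≡ l
erase-insert k []      = erase-head k []
erase-insert k (p ∷ l) with below? k p in eq
... | yes _ = erase-head k (p ∷ l)
... | no  _ rewrite eq = cong (p ∷_) (erase-insert k l)

insert-injective : ∀ k {l l′} → insert k l ≡ insert k l′ → l ≡ l′
insert-injective k {l} {l′} eq =
  trans (sym (erase-insert k l)) (trans (cong (erase k) eq) (erase-insert k l′))

Canonical-insert : ∀ {m k l} → 1 ≤ k → k ≤ m → Canonical m l → Canonical m (insert k l)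
Canonical-insert k≥1 k≤m [] = cons k≥1 (Below-bound-false _ false _ k≤m) []
Canonical-insert {k = k} k≥1 k≤m (cons {j} {o} j≥1 below can) with below? k (j , o)
... | yes j-below = cons k≥1 (Below-bound-false _ false _ k≤m) (cons j≥1 j-below can)
... | no  ¬below  = cons j≥1 below (Canonical-insert k≥1 (≮⇒≥ λ j<k → ¬below (smaller j<k)) can)

size-insert : ∀ k l → size (insert k l) ≡ k + size l
size-insert k []      = refl
size-insert k ((j , o) ∷ l) with below? k (j , o)
... | yes _ = refl
... | no  _ = trans (cong (_+_ j) (size-insert k l))
  (solve 3 (λ j k z → j :+ (k :+ z) := k :+ (j :+ z)) refl j k (size l))

length-insert : ∀ k l → length (insert k l) ≡ suc (length l)
length-insert k []      = refl
length-insert k (p ∷ l) with below? k p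
... | yes _ = refl
... | no  _ = cong suc (length-insert k l)

numOddNonOver-insert : ∀ k → isOdd k ≡ false → ∀ l → numOddNonOver (insert k l) ≡ numOddNonOver l
numOddNonOver-insert k even [] rewrite even = refl
numOddNonOver-insert k even ((j , o) ∷ l) with below? k (j , o)
... | yes _ rewrite even = refl
numOddNonOver-insert k even ((j , false) ∷ l) | no _ =
  cong (_+_ (if isOdd j then 1 else 0)) (numOddNonOver-insert k even l)
numOddNonOver-insert k even ((j , true)  ∷ l) | no _ = numOddNonOver-insert k even l

insertMany : ℕ → ℕ → Overpartition → Overpartition
insertMany zero    k l = l
insertMany (suc n) k l = insert k (insertMany n k l)

insertMany-injective : ∀ n k {l l′} → insertMany n k l ≡ insertMany n k l′ → l ≡ l′
insertMany-injective zero    k eq = eq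
insertMany-injective (suc n) k eq = insertMany-injective n k (insert-injective k eq)

Canonical-insertMany : ∀ n {m k l} → 1 ≤ k → k ≤ m → Canonical m l → Canonical m (insertMany n k l)
Canonical-insertMany zero    k≥1 k≤m can = can
Canonical-insertMany (suc n) k≥1 k≤m can = Canonical-insert k≥1 k≤m (Canonical-insertMany n k≥1 k≤m can)

size-insertMany : ∀ n k l → size (insertMany n k l) ≡ n * k + size l
size-insertMany zero    k l = refl
size-insertMany (suc n) k l = trans (size-insert k (insertMany n k l))
  (trans (cong (_+_ k) (size-insertMany n k l)) (sym (+-assoc k (n * k) (size l))))

length-insertMany : ∀ n k l → length (insertMany n k l) ≡ n + length l
length-insertMany zero    k l = refl
length-insertMany (suc n) k l = trans (length-insert k (insertMany n k l)) (cong suc (length-insertMany n k l))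

numOddNonOver-insertMany : ∀ n k → isOdd k ≡ false → ∀ l →
  numOddNonOver (insertMany n k l) ≡ numOddNonOver l
numOddNonOver-insertMany zero    k even l = refl
numOddNonOver-insertMany (suc n) k even l =
  trans (numOddNonOver-insert k even (insertMany n k l)) (numOddNonOver-insertMany n k even l)

-- d + j copies of 4, of which j are split as 2 + 2.
mix : ℕ → ℕ → Overpartition → Overpartition
mix d j l = insertMany (2 * j) 2 (insertMany d 4 l)

length-mix : ∀ d j l → length (mix d j l) ≡ length l + (d + j) + j
length-mix d j l = begin
  length (mix d j l)                      ≡⟨ length-insertMany (2 * j) 2 (insertMany d 4 l) ⟩
  2 * j + length (insertMany d 4 l)       ≡⟨ cong (_+_ (2 * j)) (length-insertMany d 4 l) ⟩
  2 * j + (d + length l)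
    ≡⟨ solve 3 (λ j d z → con 2 :* j :+ (d :+ z) := z :+ (d :+ j) :+ j) refl j d (length l) ⟩
  length l + (d + j) + j ∎
  where open ≡-Reasoning

size-mix : ∀ d j l → size (mix d j l) ≡ (d + j) * 4 + size l
size-mix d j l = begin
  size (mix d j l)                        ≡⟨ size-insertMany (2 * j) 2 (insertMany d 4 l) ⟩
  2 * j * 2 + size (insertMany d 4 l)     ≡⟨ cong (_+_ (2 * j * 2)) (size-insertMany d 4 l) ⟩
  2 * j * 2 + (d * 4 + size l)
    ≡⟨ solve 3 (λ j d z → con 2 :* j :* con 2 :+ (d :* con 4 :+ z) := (d :+ j) :* con 4 :+ z)
         refl j d (size l) ⟩
  (d + j) * 4 + size l ∎
  where open ≡-Reasoning

numOddNonOver-mix : ∀ d j p l → numOddNonOver (p ∷ mix d j l) ≡ numOddNonOver (p ∷ l)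
numOddNonOver-mix d j p l = extend p (trans (numOddNonOver-insertMany (2 * j) 2 refl (insertMany d 4 l))
  (numOddNonOver-insertMany d 4 refl l))
  where
  extend : ∀ p {l l′} → numOddNonOver l ≡ numOddNonOver l′ → numOddNonOver (p ∷ l) ≡ numOddNonOver (p ∷ l′)
  extend (k , false) eq = cong (_+_ (if isOdd k then 1 else 0)) eq
  extend (k , true)  eq = eq

chi-head : ∀ p l l′ → chi (p ∷ l) ≡ chi (p ∷ l′)
chi-head (k , false) l l′ = refl
chi-head (k , true)  l l′ = refl

-- The head p fixes the largest part and `chi`, and 2 and 4 are even; only the number of parts
-- changes, growing by d + 2j.
m2rank-mix : ∀ d j p l → m2rank (p ∷ mix d j l) ≡ m2rank (p ∷ l) ℤ.- + (d + j) ℤ.- + j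
m2rank-mix d j p l = begin
  A ℤ.- + suc (length (mix d j l)) ℤ.- + numOddNonOver (p ∷ mix d j l) ℤ.- + chi (p ∷ mix d j l)
    ≡⟨ cong₂ (λ x y → A ℤ.- + suc (length (mix d j l)) ℤ.- + x ℤ.- + y)
         (numOddNonOver-mix d j p l) (chi-head p (mix d j l) l) ⟩
  A ℤ.- + suc (length (mix d j l)) ℤ.- O ℤ.- X
    ≡⟨ cong (λ x → A ℤ.- + suc x ℤ.- O ℤ.- X) (length-mix d j l) ⟩
  A ℤ.- + (suc (length l) + (d + j) + j) ℤ.- O ℤ.- X
    ≡⟨ cong (λ x → A ℤ.- x ℤ.- O ℤ.- X) (trans (ℤₚ.pos-+ (suc (length l) + (d + j)) j)
         (cong (ℤ._+ + j) (ℤₚ.pos-+ (suc (length l)) (d + j)))) ⟩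
  A ℤ.- (+ suc (length l) ℤ.+ + (d + j) ℤ.+ + j) ℤ.- O ℤ.- X
    ≡⟨ solveℤ 6 (λ a l d j o x → a :- (l :+′ d :+′ j) :- o :- x :=′ a :- l :- o :- x :- d :- j) refl
         A (+ suc (length l)) (+ (d + j)) (+ j) O X ⟩
  m2rank (p ∷ l) ℤ.- + (d + j) ℤ.- + j ∎
  where
  open ≡-Reasoning
  open ℤSolver.+-*-Solver using (_:-_) renaming (solve to solveℤ; _:=_ to _:=′_; _:+_ to _:+′_)
  A = + ceilHalf (proj₁ p)
  O = + numOddNonOver (p ∷ l)
  X = + chi (p ∷ l)

-- The modulus is `suc c`. One 4 is inserted first, so that the head p is at least 4 and stays in
-- place; c further fours go behind it, j of them split. Keeping j in the image allows the
-- insertions to be undone.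
data Adjusts (c : ℕ) (l : Overpartition) : Overpartition × ℕ → Set where
  adjusts : ∀ {μ j} p r → insert 4 l ≡ p ∷ r → μ ≡ p ∷ mix (c ∸ j) j r → Adjusts c l (μ , j)

Adjusts-injective : ∀ {c l l′ y} → Adjusts c l y → Adjusts c l′ y → l ≡ l′
Adjusts-injective {c} (adjusts {j = j} p r eq refl) (adjusts p′ r′ eq′ μ≡)
  with refl , rest ← ∷-injective μ≡
  with refl ← insertMany-injective (c ∸ j) 4 (insertMany-injective (2 * j) 2 rest) =
  insert-injective 4 (trans eq (sym eq′))

insert-nonempty : ∀ k l → ∃[ p ] ∃[ r ] (insert k l ≡ p ∷ r × k ≤ proj₁ p)
insert-nonempty k []            = _ , _ , refl , ≤-refl
insert-nonempty k ((j , o) ∷ l) with below? k (j , o)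
... | yes _      = _ , _ , refl , ≤-refl
... | no  ¬below = _ , _ , refl , ≮⇒≥ λ j<k → ¬below (smaller j<k)

residue-reached : ∀ (z : ℤ) r d .{{_ : NonZero d}} → r < d → ∃[ j ] (j < d × (z ℤ.- + j) %ℕ d ≡ r)
residue-reached z r d r<d = j , n%ℕd<d w d , %ℕ-unique _ (w /ℕ d) r d r<d (begin
  z ℤ.- + j                             ≡⟨ solveℤ 3 (λ z r j → z :- j :=′ (z :- r) :- j :+′ r) refl z (+ r) (+ j) ⟩
  w ℤ.- + j ℤ.+ + r                     ≡⟨ cong (λ x → x ℤ.- + j ℤ.+ + r) (a≡a%ℕn+[a/ℕn]*n w d) ⟩
  (+ j ℤ.+ w /ℕ d ℤ.* + d) ℤ.- + j ℤ.+ + r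
    ≡⟨ solveℤ 3 (λ x r j → (j :+′ x) :- j :+′ r :=′ r :+′ x) refl (w /ℕ d ℤ.* + d) (+ r) (+ j) ⟩
  + r ℤ.+ w /ℕ d ℤ.* + d ∎)
  where
  open ≡-Reasoning
  open ℤSolver.+-*-Solver using (_:-_) renaming (solve to solveℤ; _:=_ to _:=′_; _:+_ to _:+′_)
  w = z ℤ.- + r
  j = w %ℕ d

-- For each overpartition of n some j < c + 1 moves the rank into the wanted class; the result
-- together with j determines the overpartition.
N2-lower : ∀ a c n N → suc c * 4 + n ≡ N → length (overpartitions n) ≤ N2 a (suc c) N * suc c
N2-lower a c n N N≡ = subst (length (overpartitions n) ≤_)
  (trans (length-cartesianProduct hits (upTo (suc c))) (cong (length hits *_) (length-upTo (suc c))))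
  (length-≤-via (Adjusts c) Adjusts-injective (overpartitions-unique n) adjust)
  where
  hit? = λ (l : Overpartition) → (m2rank l %ℕ suc c) ≟ (a % suc c)
  hits = filter hit? (overpartitions N)
  adjusted : ∀ {m} l p r j → insert 4 l ≡ p ∷ r → 4 ≤ proj₁ p → Canonical m (p ∷ r) → size l ≡ n →
    j ≤ c → (m2rank (p ∷ r) ℤ.- + c ℤ.- + j) %ℕ suc c ≡ a % suc c → p ∷ mix (c ∸ j) j r ∈ hits
  adjusted {m} l p@(k , o) r j ins≡ 4≤k (cons k≥1 below can) size≡ j≤c rank≡ = ∈-filter⁺ hit?
    (∈-overpartitions⁺ {m} (cons k≥1 below
      (Canonical-insertMany (2 * j) (s≤s z≤n) (≤-trans (s≤s (s≤s z≤n)) 4≤k)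
        (Canonical-insertMany (c ∸ j) (s≤s z≤n) 4≤k can))) sizes)
    (trans (cong (_%ℕ suc c) rank) rank≡)
    where
    open ≡-Reasoning
    d+j≡c : c ∸ j + j ≡ c
    d+j≡c = m∸n+n≡m j≤c
    rank : m2rank (p ∷ mix (c ∸ j) j r) ≡ m2rank (p ∷ r) ℤ.- + c ℤ.- + j
    rank = trans (m2rank-mix (c ∸ j) j p r) (cong (λ x → m2rank (p ∷ r) ℤ.- + x ℤ.- + j) d+j≡c)
    sizes : k + size (mix (c ∸ j) j r) ≡ N
    sizes = begin
      k + size (mix (c ∸ j) j r)     ≡⟨ cong (_+_ k) (size-mix (c ∸ j) j r) ⟩
      k + ((c ∸ j + j) * 4 + size r) ≡⟨ cong (λ x → k + (x * 4 + size r)) d+j≡c ⟩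
      k + (c * 4 + size r)           ≡⟨ solve 3 (λ k x z → k :+ (x :+ z) := x :+ (k :+ z)) refl k (c * 4) (size r) ⟩
      c * 4 + (k + size r)           ≡⟨ cong (λ l → c * 4 + size l) (sym ins≡) ⟩
      c * 4 + size (insert 4 l)      ≡⟨ cong (_+_ (c * 4)) (trans (size-insert 4 l) (cong (_+_ 4) size≡)) ⟩
      c * 4 + (4 + n)                ≡⟨ solve 2 (λ x n → x :+ (con 4 :+ n) := con 4 :+ x :+ n) refl (c * 4) n ⟩
      suc c * 4 + n                  ≡⟨ N≡ ⟩
      N ∎
  adjust : ∀ {l} → l ∈ overpartitions n →
    ∃[ y ] (y ∈ cartesianProduct hits (upTo (suc c)) × Adjusts c l y)
  adjust {l} l∈ =
    let can , size≡ = ∈-overpartitions⁻ {n} l∈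
        p , r , ins≡ , 4≤k = insert-nonempty 4 l
        -- The rank of `p ∷ r` already counts the first 4. The other c fours lower it by c whatever
        -- j is, so j is chosen after subtracting c.
        j , j<d , rank≡ = residue-reached (m2rank (p ∷ r) ℤ.- + c) (a % suc c) (suc c) (m%n<n a (suc c))
        can′ = subst (Canonical (suc n + 4)) ins≡
          (Canonical-insert (s≤s z≤n) (m≤n+m 4 (suc n)) (Canonical-mono (m≤m+n (suc n) 4) can))
    in (p ∷ mix (c ∸ j) j r , j) ,
       ∈-cartesianProduct⁺ (adjusted l p r j ins≡ 4≤k can′ size≡ (s≤s⁻¹ j<d) rank≡) (∈-upTo⁺ j<d) ,
       adjusts p r ins≡ refl

-- Each residue class has a positive proportion; the inequality

overpartitions-ratio^ : ∀ k n → length (overpartitions (k + n)) ≤ 3 ^ k * length (overpartitions n)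
overpartitions-ratio^ zero    n = ≤-reflexive (sym (+-identityʳ _))
overpartitions-ratio^ (suc k) n = begin
  length (overpartitions (suc k + n))         ≤⟨ overpartitions-ratio (k + n) ⟩
  3 * length (overpartitions (k + n))         ≤⟨ *-monoʳ-≤ 3 (overpartitions-ratio^ k n) ⟩
  3 * (3 ^ k * length (overpartitions n))     ≡⟨ sym (*-assoc 3 (3 ^ k) _) ⟩
  3 ^ suc k * length (overpartitions n)       ∎
  where open ≤-Reasoning

-- Descending from n to n - k with k = 4(c + 1) costs a factor of at most 3^k, and the inserted
-- fours restore the size n.
N2-proportion : ∀ a c → ∃[ C ] (∀ n → suc c * 4 ≤ n →
  length (overpartitions n) ≤ C * N2 a (suc c) n)
N2-proportion a c = 3 ^ k * suc c , λ n k≤n → begin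
  p n                                 ≡⟨ cong p (sym (m+[n∸m]≡n k≤n)) ⟩
  p (k + (n ∸ k))                     ≤⟨ overpartitions-ratio^ k (n ∸ k) ⟩
  3 ^ k * p (n ∸ k)                   ≤⟨ *-monoʳ-≤ (3 ^ k) (N2-lower a c (n ∸ k) n (m+[n∸m]≡n k≤n)) ⟩
  3 ^ k * (N2 a (suc c) n * suc c)    ≡⟨ cong (3 ^ k *_) (*-comm (N2 a (suc c) n) (suc c)) ⟩
  3 ^ k * (suc c * N2 a (suc c) n)    ≡⟨ sym (*-assoc (3 ^ k) (suc c) (N2 a (suc c) n)) ⟩
  3 ^ k * suc c * N2 a (suc c) n      ∎
  where
  open ≤-Reasoning
  k = suc c * 4
  p = λ n → length (overpartitions n)

overpartitions-nonempty : ∀ n → 1 ≤ length (overpartitions n)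
overpartitions-nonempty n = ∈-length (∈-overpartitions⁺ {1} {ones n}
  (subst (Canonical 1) (++-identityʳ (ones n)) (Canonical-replicate n ≤-refl ≤-refl []))
  (trans (size-replicate n 1) (*-identityʳ n)))

-- With D = 9 C^2 the hypotheses give p (D + 1) ≤ y z D; the spare p, at least 1, makes x D < y z D
-- strict.
product-dominates : ∀ C {x y z p q r} → x ≤ p → 1 ≤ p → p * suc (9 * (C * C)) ≤ 9 * (q * r) →
  q ≤ C * y → r ≤ C * z → x < y * z
product-dominates C {x} {y} {z} {p} {q} {r} x≤p p≥1 super q≤ r≤ = *-cancelʳ-< D x (y * z) (begin-strict
  x * D                  ≤⟨ *-monoˡ-≤ D x≤p ⟩
  p * D                  <⟨ m<n+m (p * D) p≥1 ⟩
  p + p * D              ≡⟨ sym (*-suc p D) ⟩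
  p * suc D              ≤⟨ super ⟩
  9 * (q * r)            ≤⟨ *-monoʳ-≤ 9 (*-mono-≤ q≤ r≤) ⟩
  9 * (C * y * (C * z))
    ≡⟨ solve 3 (λ C y z → con 9 :* (C :* y :* (C :* z)) := y :* z :* (con 9 :* (C :* C))) refl C y z ⟩
  y * z * D ∎)
  where
  open ≤-Reasoning
  D = 9 * (C * C)

N2-≤ : ∀ a c n → N2 a (suc c) n ≤ length (overpartitions n)
N2-≤ a c n = length-filter (λ l → (m2rank l %ℕ suc c) ≟ (a % suc c)) (overpartitions n)

N2-ordered : ∀ a c → ∃[ N ] (∀ m n → m ≤ n → N ≤ m →
  N2 a (suc c) (m + n) < N2 a (suc c) m * N2 a (suc c) n)
N2-ordered a c = combine (N2-proportion a c)
  where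
  f = N2 a (suc c)
  p = λ n → length (overpartitions n)
  combine′ : ∀ C k → (∀ n → k ≤ n → p n ≤ C * f n) →
    ∃[ N ] (∀ m n → m ≤ n → N ≤ m → p (m + n) * suc (9 * (C * C)) ≤ 9 * (p m * p n)) →
    ∃[ N ] (∀ m n → m ≤ n → N ≤ m → f (m + n) < f m * f n)
  combine′ C k proportion (N , super) = k ⊔ N , λ m n m≤n N≤m →
    product-dominates C (N2-≤ a c (m + n)) (overpartitions-nonempty (m + n))
      (super m n m≤n (≤-trans (m≤n⊔m k N) N≤m))
      (proportion m (≤-trans (m≤m⊔n k N) N≤m))
      (proportion n (≤-trans (≤-trans (m≤m⊔n k N) N≤m) m≤n))
  combine : ∃[ C ] (∀ n → suc c * 4 ≤ n → p n ≤ C * f n) →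
    ∃[ N ] (∀ m n → m ≤ n → N ≤ m → f (m + n) < f m * f n)
  combine (C , proportion) =
    -- K exceeds by one the total loss 9 C^2, which is C for each of the two factors and the 9 from
    -- cutting.
    combine′ C (suc c * 4) proportion (overpartitions-supermultiplicative (suc (9 * (C * C))))

theorem1p2 : (c : ℕ) → .{{_ : NonZero c}} → 2 ≤ c → ¬ (2 ∣ c) → (a : ℕ) → a < c →
    ∃[ N ] ((n₁ n₂ : ℕ) → N ≤ n₁ → N ≤ n₂ → N2 a c n₁ * N2 a c n₂ > N2 a c (n₁ + n₂))
theorem1p2 (suc c) _ _ a _ = symmetrise (N2-ordered a c)
  where
  f = N2 a (suc c)
  symmetrise : ∃[ N ] (∀ m n → m ≤ n → N ≤ m → f (m + n) < f m * f n) →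
    ∃[ N ] ((n₁ n₂ : ℕ) → N ≤ n₁ → N ≤ n₂ → f n₁ * f n₂ > f (n₁ + n₂))
  symmetrise (N , ordered) = N , λ n₁ n₂ N≤n₁ N≤n₂ → either n₁ n₂ N≤n₁ N≤n₂ (≤-total n₁ n₂)
    where
    either : ∀ n₁ n₂ → N ≤ n₁ → N ≤ n₂ → n₁ ≤ n₂ ⊎ n₂ ≤ n₁ → f (n₁ + n₂) < f n₁ * f n₂
    either n₁ n₂ N≤n₁ N≤n₂ (inj₁ n₁≤n₂) = ordered n₁ n₂ n₁≤n₂ N≤n₁
    either n₁ n₂ N≤n₁ N≤n₂ (inj₂ n₂≤n₁) =
      subst₂ _<_ (cong f (+-comm n₂ n₁)) (*-comm (f n₂) (f n₁)) (ordered n₂ n₁ n₂≤n₁ N≤n₂)
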